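{- Let $\lambda$ be a nonzero real number and let $r\ge 1$ be an integer. Then, as formal power series in $t$, $$-\frac{\log_{\lambda}(1-t)}{(1-t)^{r}}=\sum_{n=1}^{\infty}H_{n,\lambda}^{(r)}t^{n},$$ and $H_{0,\lambda}^{(r)}=0$.
   Context: For real $x$ and integer $k\ge0$: $(x)_{0,\lambda}=1$, $(x)_{k,\lambda}=x(x-\lambda)(x-2\lambda)\cdots(x-(k-1)\lambda)$ for $k\ge1$ (so $(1)_{k,1/\lambda}$ denotes this product with step $1/\lambda$). The degenerate logarithm is the formal power series $\log_{\lambda}(1+t)=\sum_{k=1}^{\infty}\lambda^{k-1}(1)_{k,1/\lambda}\frac{t^{k}}{k!}$ (equivalently $\log_\lambda(1+t)=((1+t)^\lambda-1)/\lambda$); it is the compositional inverse of the degenerate exponential $e_\lambda(t)=\sum_{k\ge0}(1)_{k,\lambda}t^k/k!=(1+\lambda t)^{1/\lambda}$. The degenerate harmonic numbers are $H_{0,\lambda}=0$ and $H_{n,\lambda}=\sum_{k=1}^{n}\frac{1}{\lambda}\binom{\lambda}{k}(-1)^{k-1}$ for $n\ge1$. The degenerate hyperharmonic numbers are defined by $H_{n,\lambda}^{(1)}=H_{n,\lambda}$ and $H_{n,\lambda}^{(r)}=\sum_{k=1}^{n}H_{k,\lambda}^{(r-1)}$ for $r\ge2$ (so $H^{(r)}_{0,\lambda}$ is an empty sum for $r\ge 2$). -}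

module Defs where

open import Algebra.Bundles using (CommutativeRing; RawSemiring; Semiring)
import Algebra.Definitions.RawSemiring as RawSemiringDefinitions
open import Algebra.Structures using (IsCommutativeRing)
open import Data.Fin.Base using (Fin; zero; suc; toℕ)
open import Data.Integer.Base using (+_)
open import Data.Nat.Base as ℕ using (ℕ; zero; suc; _∸_; _!)
import Data.Nat.Properties as ℕ
open import Data.Product.Base using (∃-syntax; _×_; _,_)
open import Data.Rational.Base as ℚ using (ℚ; 0ℚ; 1ℚ; ∣_∣)
import Data.Rational.Properties as ℚ
open import Data.Rational.Solver using (module +-*-Solver)
open import Data.Vec.Functional as Vector using (Vector; _∷_)
open import Level using (0ℓ)
open import Relation.Binary.PropositionalEquality as ≡ using (_≡_; refl; cong; cong₂; subst; subst₂)
open import Relation.Nullary using (yes; no; contradiction)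

private
  open +-*-Solver

  abstract
    halve : ∀ ε → 0ℚ ℚ.< ε → ∃[ δ ] 0ℚ ℚ.< δ × δ ℚ.+ δ ≡ ε
    halve ε 0<ε = ℚ.½ ℚ.* ε , 0<½ε , eq
      where
      0<½ε : 0ℚ ℚ.< ℚ.½ ℚ.* ε
      0<½ε = subst (ℚ._< ℚ.½ ℚ.* ε) (ℚ.*-zeroʳ ℚ.½) (ℚ.*-monoʳ-<-pos ℚ.½ 0<ε)
      eq : ℚ.½ ℚ.* ε ℚ.+ ℚ.½ ℚ.* ε ≡ ε
      eq = ≡.trans (≡.sym (ℚ.*-distribʳ-+ ε ℚ.½ ℚ.½)) (ℚ.*-identityˡ ε)

    *-pos : ∀ {p q} → 0ℚ ℚ.< p → 0ℚ ℚ.< q → 0ℚ ℚ.< p ℚ.* q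
    *-pos {p} {q} 0<p 0<q = subst (ℚ._< p ℚ.* q) (ℚ.*-zeroʳ p) (ℚ.*-monoʳ-<-pos p {{ℚ.positive 0<p}} 0<q)

    divide : ∀ B ε → 0ℚ ℚ.< B → 0ℚ ℚ.< ε → ∃[ δ ] 0ℚ ℚ.< δ × B ℚ.* δ ≡ ε
    divide B ε 0<B 0<ε = (ℚ.1/ B) ℚ.* ε , *-pos (ℚ.positive⁻¹ (ℚ.1/ B) {{ℚ.1/pos⇒pos B}}) 0<ε , eq
      where
      instance
        B-pos : ℚ.Positive B
        B-pos = ℚ.positive 0<B
        B-nonZero : ℚ.NonZero B
        B-nonZero = ℚ.pos⇒nonZero B
      eq : B ℚ.* ((ℚ.1/ B) ℚ.* ε) ≡ ε
      eq = ≡.trans (≡.sym (ℚ.*-assoc B (ℚ.1/ B) ε))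
             (≡.trans (cong (ℚ._* ε) (ℚ.*-inverseʳ B)) (ℚ.*-identityˡ ε))

    ∣-∣-comm : ∀ p q → ∣ p ℚ.- q ∣ ≡ ∣ q ℚ.- p ∣
    ∣-∣-comm p q = ≡.trans (≡.sym (ℚ.∣-p∣≡∣p∣ (p ℚ.- q)))
      (cong ∣_∣ (solve 2 (λ p q → :- (p :- q) := q :- p) refl p q))

    +-close : ∀ {a b δ η} → ∣ a ∣ ℚ.< δ → ∣ b ∣ ℚ.< η → ∣ a ℚ.+ b ∣ ℚ.< δ ℚ.+ η
    +-close {a} {b} a<δ b<η = ℚ.≤-<-trans (ℚ.∣p+q∣≤∣p∣+∣q∣ a b) (ℚ.+-mono-< a<δ b<η)

    *-bound : ∀ {a b B δ} → 0ℚ ℚ.< B → ∣ a ∣ ℚ.≤ B → ∣ b ∣ ℚ.< δ → ∣ a ℚ.* b ∣ ℚ.< B ℚ.* δ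
    *-bound {a} {b} {B} 0<B a≤B b<δ = ℚ.≤-<-trans
      (subst (ℚ._≤ B ℚ.* ∣ b ∣) (≡.sym (ℚ.∣p*q∣≡∣p∣*∣q∣ a b))
        (ℚ.*-monoʳ-≤-nonNeg ∣ b ∣ {{ℚ.∣-∣-nonNeg b}} a≤B))
      (ℚ.*-monoʳ-<-pos B {{ℚ.positive 0<B}} b<δ)

    *-close : ∀ {a a′ b b′ A B δ η} → 0ℚ ℚ.< A → 0ℚ ℚ.< B → ∣ a ∣ ℚ.≤ A → ∣ b′ ∣ ℚ.≤ B →
              ∣ b ℚ.- b′ ∣ ℚ.< δ → ∣ a ℚ.- a′ ∣ ℚ.< η →
              ∣ a ℚ.* b ℚ.- a′ ℚ.* b′ ∣ ℚ.< A ℚ.* δ ℚ.+ B ℚ.* η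
    *-close {a} {a′} {b} {b′} 0<A 0<B a≤A b′≤B b~b′ a~a′ =
      subst (λ z → ∣ z ∣ ℚ.< _)
        (solve 4 (λ a a′ b b′ → a :* (b :- b′) :+ b′ :* (a :- a′) := a :* b :- a′ :* b′) refl a a′ b b′)
        (+-close {a ℚ.* (b ℚ.- b′)} {b′ ℚ.* (a ℚ.- a′)}
          (*-bound {a} {b ℚ.- b′} 0<A a≤A b~b′) (*-bound {b′} {a ℚ.- a′} 0<B b′≤B a~a′))

    telescope : ∀ a b c → (a ℚ.- b) ℚ.+ (b ℚ.- c) ≡ a ℚ.- c
    telescope = solve 3 (λ a b c → (a :- b) :+ (b :- c) := a :- c) refl

    cancel : ∀ a b → (a ℚ.- b) ℚ.+ b ≡ a
    cancel = solve 2 (λ a b → (a :- b) :+ b := a) refl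

    +-rearrange : ∀ a b c d → (a ℚ.- b) ℚ.+ (c ℚ.- d) ≡ (a ℚ.+ c) ℚ.- (b ℚ.+ d)
    +-rearrange = solve 4 (λ a b c d → (a :- b) :+ (c :- d) := (a :+ c) :- (b :+ d)) refl

    neg-rearrange : ∀ a b → b ℚ.- a ≡ ℚ.- a ℚ.- ℚ.- b
    neg-rearrange = solve 2 (λ a b → b :- a := :- a :- :- b) refl

    ≤-⊔ˡ : ∀ M N {n} → M ℕ.⊔ N ℕ.≤ n → M ℕ.≤ n
    ≤-⊔ˡ M N = ℕ.m⊔n≤o⇒m≤o M N

    ≤-⊔ʳ : ∀ M N {n} → M ℕ.⊔ N ℕ.≤ n → N ℕ.≤ n
    ≤-⊔ʳ M N = ℕ.m⊔n≤o⇒n≤o M N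

-- A real number is a Cauchy sequence of rationals; two of them are equal (_≃_)
-- when their difference is a null sequence.
Cauchy : (ℕ → ℚ) → Set
Cauchy s = ∀ ε → 0ℚ ℚ.< ε → ∃[ N ] (∀ m n → N ℕ.≤ m → N ℕ.≤ n → ∣ s m ℚ.- s n ∣ ℚ.< ε)

record ℝ : Set where
  constructor mkℝ
  field
    seq    : ℕ → ℚ
    cauchy : Cauchy seq

open ℝ public

infix 4 _≃_ _#_

record _≃_ (x y : ℝ) : Set where
  constructor mk≃
  field
    close : ∀ ε → 0ℚ ℚ.< ε → ∃[ N ] (∀ n → N ℕ.≤ n → ∣ seq x n ℚ.- seq y n ∣ ℚ.< ε)

open _≃_ public

-- Apartness, the positive form of x ≠ y; it is what makes 1/x available.
_#_ : ℝ → ℝ → Set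
x # y = ∃[ δ ] 0ℚ ℚ.< δ × ∃[ N ] (∀ n → N ℕ.≤ n → δ ℚ.≤ ∣ seq x n ℚ.- seq y n ∣)

abstract
  ≗⇒≃ : ∀ {x y} → (∀ n → seq x n ≡ seq y n) → x ≃ y
  ≗⇒≃ {x} {y} eq .close ε 0<ε = 0 , λ n _ →
    subst (ℚ._< ε) (≡.sym (≡.trans (cong (λ z → ∣ seq x n ℚ.- z ∣) (≡.sym (eq n)))
                             (cong ∣_∣ (ℚ.+-inverseʳ (seq x n))))) 0<ε

private
  abstract
    ≃-refl : ∀ {x} → x ≃ x
    ≃-refl = ≗⇒≃ λ _ → refl

    ≃-sym : ∀ {x y} → x ≃ y → y ≃ x
    ≃-sym {x} {y} x≃y .close ε 0<ε =
      let N , h = close x≃y ε 0<ε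
      in N , λ n N≤n → subst (ℚ._< ε) (∣-∣-comm (seq x n) (seq y n)) (h n N≤n)

    ≃-trans : ∀ {x y z} → x ≃ y → y ≃ z → x ≃ z
    ≃-trans {x} {y} {z} x≃y y≃z .close ε 0<ε =
      let δ , 0<δ , δ+δ≡ε = halve ε 0<ε
          M , f = close x≃y δ 0<δ
          N , g = close y≃z δ 0<δ
      in M ℕ.⊔ N , λ n ≤n → subst₂ (λ w η → ∣ w ∣ ℚ.< η)
        (telescope (seq x n) (seq y n) (seq z n)) δ+δ≡ε
        (+-close {seq x n ℚ.- seq y n} {seq y n ℚ.- seq z n}
          (f n (≤-⊔ˡ M N ≤n)) (g n (≤-⊔ʳ M N ≤n)))

    const-cauchy : ∀ q → Cauchy (λ _ → q)
    const-cauchy q ε 0<ε = 0 , λ _ _ _ _ →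
      subst (ℚ._< ε) (≡.sym (cong ∣_∣ (ℚ.+-inverseʳ q))) 0<ε

    bounded : ∀ {s} → Cauchy s → ∃[ B ] 0ℚ ℚ.< B × ∃[ N ] (∀ n → N ℕ.≤ n → ∣ s n ∣ ℚ.≤ B)
    bounded {s} s-cauchy =
      let N , h = s-cauchy 1ℚ (ℚ.positive⁻¹ 1ℚ)
      in 1ℚ ℚ.+ ∣ s N ∣
       , ℚ.+-mono-<-≤ (ℚ.positive⁻¹ 1ℚ) (ℚ.0≤∣p∣ (s N))
       , N , λ n N≤n → ℚ.≤-trans
           (subst (λ w → ∣ w ∣ ℚ.≤ ∣ s n ℚ.- s N ∣ ℚ.+ ∣ s N ∣) (cancel (s n) (s N))
             (ℚ.∣p+q∣≤∣p∣+∣q∣ (s n ℚ.- s N) (s N)))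
           (ℚ.+-monoˡ-≤ ∣ s N ∣ (ℚ.<⇒≤ (h n N N≤n ℕ.≤-refl)))

    +-cauchy : ∀ {s t} → Cauchy s → Cauchy t → Cauchy (λ n → s n ℚ.+ t n)
    +-cauchy {s} {t} s-cauchy t-cauchy ε 0<ε =
      let δ , 0<δ , δ+δ≡ε = halve ε 0<ε
          M , f = s-cauchy δ 0<δ
          N , g = t-cauchy δ 0<δ
      in M ℕ.⊔ N , λ m n ≤m ≤n → subst₂ (λ w η → ∣ w ∣ ℚ.< η)
        (+-rearrange (s m) (s n) (t m) (t n)) δ+δ≡ε
        (+-close {s m ℚ.- s n} {t m ℚ.- t n}
          (f m n (≤-⊔ˡ M N ≤m) (≤-⊔ˡ M N ≤n)) (g m n (≤-⊔ʳ M N ≤m) (≤-⊔ʳ M N ≤n)))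

    neg-cauchy : ∀ {s} → Cauchy s → Cauchy (λ n → ℚ.- s n)
    neg-cauchy {s} s-cauchy ε 0<ε =
      let N , h = s-cauchy ε 0<ε
      in N , λ m n N≤m N≤n →
        subst (λ w → ∣ w ∣ ℚ.< ε) (neg-rearrange (s m) (s n)) (h n m N≤n N≤m)

    *-cauchy : ∀ {s t} → Cauchy s → Cauchy t → Cauchy (λ n → s n ℚ.* t n)
    *-cauchy {s} {t} s-cauchy t-cauchy ε 0<ε =
      let δ , 0<δ , δ+δ≡ε = halve ε 0<ε
          A , 0<A , K , a = bounded {s} s-cauchy
          B , 0<B , L , b = bounded {t} t-cauchy
          α , 0<α , Aα≡δ = divide A δ 0<A 0<δ
          β , 0<β , Bβ≡δ = divide B δ 0<B 0<δ
          M , f = t-cauchy α 0<α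
          N , g = s-cauchy β 0<β
      in (K ℕ.⊔ L) ℕ.⊔ (M ℕ.⊔ N) , λ m n ≤m ≤n →
        subst (∣ s m ℚ.* t m ℚ.- s n ℚ.* t n ∣ ℚ.<_) (≡.trans (cong₂ ℚ._+_ Aα≡δ Bβ≡δ) δ+δ≡ε)
          (*-close {s m} {s n} {t m} {t n} 0<A 0<B
            (a m (≤-⊔ˡ K L (≤-⊔ˡ (K ℕ.⊔ L) (M ℕ.⊔ N) ≤m)))
            (b n (≤-⊔ʳ K L (≤-⊔ˡ (K ℕ.⊔ L) (M ℕ.⊔ N) ≤n)))
            (f m n (≤-⊔ˡ M N (≤-⊔ʳ (K ℕ.⊔ L) (M ℕ.⊔ N) ≤m))
                   (≤-⊔ˡ M N (≤-⊔ʳ (K ℕ.⊔ L) (M ℕ.⊔ N) ≤n)))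
            (g m n (≤-⊔ʳ M N (≤-⊔ʳ (K ℕ.⊔ L) (M ℕ.⊔ N) ≤m))
                   (≤-⊔ʳ M N (≤-⊔ʳ (K ℕ.⊔ L) (M ℕ.⊔ N) ≤n))))

fromℚ : ℚ → ℝ
fromℚ q = mkℝ (λ _ → q) (const-cauchy q)

0ℝ 1ℝ : ℝ
0ℝ = fromℚ 0ℚ
1ℝ = fromℚ 1ℚ

infixl 6 _+ʳ_
infixl 7 _*ʳ_
infix  8 -ʳ_

_+ʳ_ _*ʳ_ : ℝ → ℝ → ℝ
x +ʳ y = mkℝ (λ n → seq x n ℚ.+ seq y n) (+-cauchy {seq x} {seq y} (cauchy x) (cauchy y))
x *ʳ y = mkℝ (λ n → seq x n ℚ.* seq y n) (*-cauchy {seq x} {seq y} (cauchy x) (cauchy y))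

-ʳ_ : ℝ → ℝ
-ʳ x = mkℝ (λ n → ℚ.- seq x n) (neg-cauchy {seq x} (cauchy x))

private
  abstract
    +ʳ-cong : ∀ {x x′ y y′} → x ≃ x′ → y ≃ y′ → x +ʳ y ≃ x′ +ʳ y′
    +ʳ-cong {x} {x′} {y} {y′} p q .close ε 0<ε =
      let δ , 0<δ , δ+δ≡ε = halve ε 0<ε
          M , f = close p δ 0<δ
          N , g = close q δ 0<δ
      in M ℕ.⊔ N , λ n ≤n → subst₂ (λ w η → ∣ w ∣ ℚ.< η)
        (+-rearrange (seq x n) (seq x′ n) (seq y n) (seq y′ n)) δ+δ≡ε
        (+-close {seq x n ℚ.- seq x′ n} {seq y n ℚ.- seq y′ n}
          (f n (≤-⊔ˡ M N ≤n)) (g n (≤-⊔ʳ M N ≤n)))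

    -ʳ‿cong : ∀ {x y} → x ≃ y → -ʳ x ≃ -ʳ y
    -ʳ‿cong {x} {y} p .close ε 0<ε =
      let N , h = close (≃-sym p) ε 0<ε
      in N , λ n N≤n → subst (λ w → ∣ w ∣ ℚ.< ε) (neg-rearrange (seq x n) (seq y n)) (h n N≤n)

    *ʳ-cong : ∀ {x x′ y y′} → x ≃ x′ → y ≃ y′ → x *ʳ y ≃ x′ *ʳ y′
    *ʳ-cong {x} {x′} {y} {y′} p q .close ε 0<ε =
      let δ , 0<δ , δ+δ≡ε = halve ε 0<ε
          A , 0<A , K , a = bounded {seq x} (cauchy x)
          B , 0<B , L , b = bounded {seq y′} (cauchy y′)
          α , 0<α , Aα≡δ = divide A δ 0<A 0<δ
          β , 0<β , Bβ≡δ = divide B δ 0<B 0<δ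
          M , f = close q α 0<α
          N , g = close p β 0<β
      in (K ℕ.⊔ L) ℕ.⊔ (M ℕ.⊔ N) , λ n ≤n →
        subst (∣ seq x n ℚ.* seq y n ℚ.- seq x′ n ℚ.* seq y′ n ∣ ℚ.<_)
          (≡.trans (cong₂ ℚ._+_ Aα≡δ Bβ≡δ) δ+δ≡ε)
          (*-close {seq x n} {seq x′ n} {seq y n} {seq y′ n} 0<A 0<B
            (a n (≤-⊔ˡ K L (≤-⊔ˡ (K ℕ.⊔ L) (M ℕ.⊔ N) ≤n)))
            (b n (≤-⊔ʳ K L (≤-⊔ˡ (K ℕ.⊔ L) (M ℕ.⊔ N) ≤n)))
            (f n (≤-⊔ˡ M N (≤-⊔ʳ (K ℕ.⊔ L) (M ℕ.⊔ N) ≤n)))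
            (g n (≤-⊔ʳ M N (≤-⊔ʳ (K ℕ.⊔ L) (M ℕ.⊔ N) ≤n))))

ℝ-isCommutativeRing : IsCommutativeRing _≃_ _+ʳ_ _*ʳ_ -ʳ_ 0ℝ 1ℝ
ℝ-isCommutativeRing = record
  { isRing = record
    { +-isAbelianGroup = record
      { isGroup = record
        { isMonoid = record
          { isSemigroup = record
            { isMagma = record
              { isEquivalence = record { refl = ≃-refl ; sym = ≃-sym ; trans = ≃-trans }
              ; ∙-cong = +ʳ-cong
              }
            ; assoc = λ x y z → ≗⇒≃ λ n → ℚ.+-assoc (seq x n) (seq y n) (seq z n)
            }
          ; identity = (λ x → ≗⇒≃ λ n → ℚ.+-identityˡ (seq x n))
                     , (λ x → ≗⇒≃ λ n → ℚ.+-identityʳ (seq x n))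
          }
        ; inverse = (λ x → ≗⇒≃ λ n → ℚ.+-inverseˡ (seq x n))
                  , (λ x → ≗⇒≃ λ n → ℚ.+-inverseʳ (seq x n))
        ; ⁻¹-cong = -ʳ‿cong
        }
      ; comm = λ x y → ≗⇒≃ λ n → ℚ.+-comm (seq x n) (seq y n)
      }
    ; *-cong = *ʳ-cong
    ; *-assoc = λ x y z → ≗⇒≃ λ n → ℚ.*-assoc (seq x n) (seq y n) (seq z n)
    ; *-identity = (λ x → ≗⇒≃ λ n → ℚ.*-identityˡ (seq x n))
                 , (λ x → ≗⇒≃ λ n → ℚ.*-identityʳ (seq x n))
    ; distrib = (λ x y z → ≗⇒≃ λ n → ℚ.*-distribˡ-+ (seq x n) (seq y n) (seq z n))
              , (λ x y z → ≗⇒≃ λ n → ℚ.*-distribʳ-+ (seq x n) (seq y n) (seq z n))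
    }
  ; *-comm = λ x y → ≗⇒≃ λ n → ℚ.*-comm (seq x n) (seq y n)
  }

ℝ-commutativeRing : CommutativeRing 0ℓ 0ℓ
ℝ-commutativeRing = record { isCommutativeRing = ℝ-isCommutativeRing }

-- Totalised by 0 ↦ 0; a sequence apart from 0 vanishes at most finitely often.
recip : ℚ → ℚ
recip q with q ℚ.≟ 0ℚ
... | yes _  = 0ℚ
... | no q≢0 = (ℚ.1/ q) {{ℚ.≢-nonZero q≢0}}

private
  abstract
    recip-inverse : ∀ {δ} q → 0ℚ ℚ.< δ → δ ℚ.≤ ∣ q ∣ → q ℚ.* recip q ≡ 1ℚ
    recip-inverse q 0<δ δ≤q with q ℚ.≟ 0ℚ
    ... | yes refl = contradiction (ℚ.<-≤-trans 0<δ δ≤q) (ℚ.<-irrefl refl)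
    ... | no q≢0   = ℚ.*-inverseʳ q {{ℚ.≢-nonZero q≢0}}

    recip-close : ∀ {δ ε} a b → 0ℚ ℚ.< δ → 0ℚ ℚ.< ε → δ ℚ.≤ ∣ a ∣ → δ ℚ.≤ ∣ b ∣ →
                  ∣ b ℚ.- a ∣ ℚ.< (δ ℚ.* δ) ℚ.* ε → ∣ recip a ℚ.- recip b ∣ ℚ.< ε
    recip-close {δ} {ε} a b 0<δ 0<ε δ≤a δ≤b h =
      ℚ.*-cancelˡ-<-nonNeg ∣ a ℚ.* b ∣ {{ℚ.∣-∣-nonNeg (a ℚ.* b)}}
        (subst (ℚ._< ∣ a ℚ.* b ∣ ℚ.* ε) lhs
          (ℚ.<-≤-trans h (ℚ.*-monoʳ-≤-nonNeg ε {{ℚ.pos⇒nonNeg ε {{ℚ.positive 0<ε}}}} δδ≤ab)))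
      where
      lhs : ∣ b ℚ.- a ∣ ≡ ∣ a ℚ.* b ∣ ℚ.* ∣ recip a ℚ.- recip b ∣
      lhs = ≡.trans (cong ∣_∣ (≡.sym (≡.trans
              (solve 4 (λ a b a′ b′ → (a :* b) :* (a′ :- b′) := b :* (a :* a′) :- a :* (b :* b′))
                refl a b (recip a) (recip b))
              (cong₂ ℚ._-_
                (≡.trans (cong (b ℚ.*_) (recip-inverse a 0<δ δ≤a)) (ℚ.*-identityʳ b))
                (≡.trans (cong (a ℚ.*_) (recip-inverse b 0<δ δ≤b)) (ℚ.*-identityʳ a))))))
            (ℚ.∣p*q∣≡∣p∣*∣q∣ (a ℚ.* b) (recip a ℚ.- recip b))
      δδ≤ab : δ ℚ.* δ ℚ.≤ ∣ a ℚ.* b ∣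
      δδ≤ab = subst (δ ℚ.* δ ℚ.≤_) (≡.sym (ℚ.∣p*q∣≡∣p∣*∣q∣ a b))
        (ℚ.≤-trans (ℚ.*-monoʳ-≤-nonNeg δ {{ℚ.pos⇒nonNeg δ {{ℚ.positive 0<δ}}}} δ≤a)
                   (ℚ.*-monoˡ-≤-nonNeg ∣ a ∣ {{ℚ.∣-∣-nonNeg a}} δ≤b))

    minus-0 : ∀ {δ} q → δ ℚ.≤ ∣ q ℚ.- 0ℚ ∣ → δ ℚ.≤ ∣ q ∣
    minus-0 {δ} q = subst (λ z → δ ℚ.≤ ∣ z ∣) (ℚ.+-identityʳ q)

    recip-cauchy : ∀ x → x # 0ℝ → Cauchy (λ n → recip (seq x n))
    recip-cauchy x (δ , 0<δ , M , f) ε 0<ε =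
      let N , g = cauchy x ((δ ℚ.* δ) ℚ.* ε) (*-pos (*-pos 0<δ 0<δ) 0<ε)
      in M ℕ.⊔ N , λ m n ≤m ≤n →
        recip-close (seq x m) (seq x n) 0<δ 0<ε
          (minus-0 (seq x m) (f m (≤-⊔ˡ M N ≤m))) (minus-0 (seq x n) (f n (≤-⊔ˡ M N ≤n)))
          (g n m (≤-⊔ʳ M N ≤n) (≤-⊔ʳ M N ≤m))

inverse : (x : ℝ) → x # 0ℝ → ℝ
inverse x x#0 = mkℝ (λ n → recip (seq x n)) (recip-cauchy x x#0)

abstract
  inverseʳ : ∀ x (x#0 : x # 0ℝ) → x *ʳ inverse x x#0 ≃ 1ℝ
  inverseʳ x (δ , 0<δ , M , f) .close ε 0<ε = M , λ n M≤n →
    subst (λ w → ∣ w ℚ.- 1ℚ ∣ ℚ.< ε)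
      (≡.sym (recip-inverse (seq x n) 0<δ (minus-0 (seq x n) (f n M≤n)))) 0<ε

module PowerSeries {c ℓ} (R : CommutativeRing c ℓ) where

  open CommutativeRing R hiding (zero; refl)
  open import Algebra.Definitions (_≈_) using (Invertible)
  open import Algebra.Definitions.RawSemiring (Semiring.rawSemiring semiring) using (sum; _^_)
  open import Relation.Binary.Reasoning.Setoid setoid

  Series : Set c
  Series = ℕ → Carrier

  infix 4 _≈ₛ_
  _≈ₛ_ : Series → Series → Set ℓ
  f ≈ₛ g = ∀ n → f n ≈ g n

  infixl 6 _+ₛ_
  infixl 7 _*ₛ_
  infix  8 -ₛ_
  infixr 8 _^ₛ_

  _+ₛ_ _*ₛ_ : Series → Series → Series
  (f +ₛ g) n = f n + g n
  (f *ₛ g) n = sum {suc n} λ i → f (toℕ i) * g (n ∸ toℕ i)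

  -ₛ_ : Series → Series
  (-ₛ f) n = - f n

  0ₛ 1ₛ X : Series
  0ₛ _ = 0#
  1ₛ zero    = 1#
  1ₛ (suc _) = 0#
  X zero          = 0#
  X (suc zero)    = 1#
  X (suc (suc _)) = 0#

  rawSemiringₛ : RawSemiring c ℓ
  rawSemiringₛ = record { _≈_ = _≈ₛ_ ; _+_ = _+ₛ_ ; _*_ = _*ₛ_ ; 0# = 0ₛ ; 1# = 1ₛ }

  _^ₛ_ : Series → ℕ → Series
  _^ₛ_ = RawSemiringDefinitions._^_ rawSemiringₛ

  -- Σ_{n ≥ 1} aₙ tⁿ
  Σ≥1 : (ℕ → Carrier) → Series
  Σ≥1 a zero    = 0#
  Σ≥1 a (suc n) = a (suc n)

  -- f(a t)
  rescale : Carrier → Series → Series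
  rescale a f n = f n * a ^ n

  UnitConstant : Series → Set _
  UnitConstant f = Invertible 1# _*_ (f 0)

  -- The coefficients gₙ, …, g₀ of g = 1/f, in this order, from
  -- f₀ g₀ = 1 and f₀ gₙ₊₁ = - Σ_{i ≤ n} fᵢ₊₁ gₙ₋ᵢ.
  recipCoeffs : (f : Series) → UnitConstant f → (n : ℕ) → Vector Carrier (suc n)
  recipCoeffs f (u , _) zero    = u ∷ Vector.[]
  recipCoeffs f (u , p) (suc n) =
    - (u * sum λ i → f (suc (toℕ i)) * recipCoeffs f (u , p) n i) ∷ recipCoeffs f (u , p) n

  recipₛ : (f : Series) → UnitConstant f → Series
  recipₛ f f₀ n = Vector.head (recipCoeffs f f₀ n)

  quotient : Series → (g : Series) → UnitConstant g → Series
  quotient f g g₀ = f *ₛ recipₛ g g₀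

  private
    sum-cong : ∀ {n} {s t : Vector Carrier n} → (∀ i → s i ≈ t i) → sum s ≈ sum t
    sum-cong {zero}  h = CommutativeRing.refl R
    sum-cong {suc n} h = +-cong (h zero) (sum-cong λ i → h (suc i))

    recipCoeffs-∸ : ∀ f f₀ n (i : Fin (suc n)) → recipCoeffs f f₀ n i ≡ recipₛ f f₀ (n ∸ toℕ i)
    recipCoeffs-∸ f f₀ n       zero    = refl
    recipCoeffs-∸ f f₀ (suc n) (suc i) = recipCoeffs-∸ f f₀ n i

  recipₛ-inverse : ∀ f f₀ → f *ₛ recipₛ f f₀ ≈ₛ 1ₛ
  recipₛ-inverse f (u , uf≈1 , fu≈1) zero = begin
    f 0 * u + 0#  ≈⟨ +-identityʳ _ ⟩
    f 0 * u       ≈⟨ fu≈1 ⟩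
    1#            ∎
  recipₛ-inverse f f₀@(u , uf≈1 , fu≈1) (suc n) = begin
    f 0 * - (u * S) + S′     ≈⟨ +-cong (sym (-‿distribʳ-* (f 0) (u * S))) (sum-cong S′≈S) ⟩
    - (f 0 * (u * S)) + S    ≈⟨ +-congʳ (-‿cong (sym (*-assoc _ _ _))) ⟩
    - ((f 0 * u) * S) + S    ≈⟨ +-congʳ (-‿cong (*-congʳ fu≈1)) ⟩
    - (1# * S) + S           ≈⟨ +-congʳ (-‿cong (*-identityˡ S)) ⟩
    - S + S                  ≈⟨ -‿inverseˡ S ⟩
    0#                       ∎
    where
    open import Algebra.Properties.Ring ring using (-‿distribʳ-*)
    S S′ : Carrier
    S  = sum λ i → f (suc (toℕ i)) * recipCoeffs f f₀ n i
    S′ = sum {suc n} λ i → f (suc (toℕ i)) * recipₛ f f₀ (n ∸ toℕ i)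
    S′≈S : ∀ i → f (suc (toℕ i)) * recipₛ f f₀ (n ∸ toℕ i) ≈ f (suc (toℕ i)) * recipCoeffs f f₀ n i
    S′≈S i = reflexive (cong (f (suc (toℕ i)) *_) (≡.sym (recipCoeffs-∸ f f₀ n i)))

  1-X : Series
  1-X = 1ₛ +ₛ (-ₛ X)

  private
    1-X^-const : ∀ r → (1-X ^ₛ r) 0 ≈ 1#
    1-X^-const zero    = CommutativeRing.refl R
    1-X^-const (suc r) = begin
      (1# - 0#) * (1-X ^ₛ r) 0 + 0#  ≈⟨ +-identityʳ _ ⟩
      (1# - 0#) * (1-X ^ₛ r) 0       ≈⟨ *-cong
                                         (trans (+-congˡ -0#≈0#) (+-identityʳ 1#)) (1-X^-const r) ⟩
      1# * 1#                        ≈⟨ *-identityˡ 1# ⟩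
      1#                             ∎
      where open import Algebra.Properties.Ring ring using (-0#≈0#)

  1-X^-unit : ∀ r → UnitConstant (1-X ^ₛ r)
  1-X^-unit r = 1# , trans (*-identityˡ _) (1-X^-const r) , trans (*-identityʳ _) (1-X^-const r)

open CommutativeRing ℝ-commutativeRing using (_-_; semiring)
open import Algebra.Definitions.RawSemiring (Semiring.rawSemiring semiring) using (sum; _^_) renaming (_×_ to _·_)
open PowerSeries ℝ-commutativeRing public

1/_! : ℕ → ℝ
1/ k ! = fromℚ (((+ 1) ℚ./ (k !)) {{k ℕ.!≢0}})

-- Σ_{k=1}^{n} aₖ
Σ₁ : ℕ → (ℕ → ℝ) → ℝ
Σ₁ n a = sum {n} λ i → a (suc (toℕ i))

-- (x)_{k,μ} = x (x - μ) ⋯ (x - (k-1) μ)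
falling : ℝ → ℕ → ℝ → ℝ
falling x zero    μ = 1ℝ
falling x (suc k) μ = falling x k μ *ʳ (x - k · μ)

binomial : ℝ → ℕ → ℝ
binomial x k = falling x k 1ℝ *ʳ 1/ k !

-- ƛ is the parameter λ.
module _ (ƛ : ℝ) (ƛ#0 : ƛ # 0ℝ) where

  -- log_λ(1 + t)
  log1+ : Series
  log1+ = Σ≥1 λ k → ƛ ^ (k ∸ 1) *ʳ falling 1ℝ k (inverse ƛ ƛ#0) *ʳ 1/ k !

  -- log_λ(1 - t)
  log1- : Series
  log1- = rescale (-ʳ 1ℝ) log1+

  harmonic : ℕ → ℝ
  harmonic n = Σ₁ n λ k → inverse ƛ ƛ#0 *ʳ binomial ƛ k *ʳ (-ʳ 1ℝ) ^ (k ∸ 1)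

  hyperharmonic : (r : ℕ) .{{_ : ℕ.NonZero r}} → ℕ → ℝ
  hyperharmonic (suc zero)    n = harmonic n
  hyperharmonic (suc (suc r)) n = Σ₁ n (hyperharmonic (suc r))

{-# OPTIONS --safe #-}
-- In R[[t]] one has (Σ_{n≥1} (a₁ + ⋯ + aₙ) tⁿ)(1 - t) = Σ_{n≥1} aₙ tⁿ, so multiplying the
-- generating function of H^{(r)} by (1 - t)^r undoes the r summations and leaves
-- Σ_{k≥1} λ⁻¹ C(λ,k) (-1)^{k-1} t^k.  Since λ^k (1)_{k,1/λ} = (λ)_{k,1}, this is -log_λ(1 - t).
module Submission where

open import Defs
open import Data.Nat.Base using (ℕ; NonZero; zero; suc; _∸_)
open import Data.Product.Base using (_×_; _,_)

open import Algebra.Bundles using (CommutativeRing; Semiring)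
open import Data.Fin.Base using (toℕ)

module CauchyProduct {c ℓ} (R : CommutativeRing c ℓ) where

  open CommutativeRing R hiding (zero)
  open import Algebra.Definitions.RawSemiring (Semiring.rawSemiring semiring) using (sum)
  open import Algebra.Properties.CommutativeSemigroup +-commutativeSemigroup using (interchange)
  open import Algebra.Properties.Ring ring using (-0#≈0#; -‿distribˡ-*; -‿distribʳ-*; -‿+-comm)
  open import Relation.Binary.Reasoning.Setoid setoid
  module P = PowerSeries R
  open P using () renaming (_≈ₛ_ to _≈ᵖ_; _+ₛ_ to _+ᵖ_; _*ₛ_ to _*ᵖ_; -ₛ_ to -ᵖ_)

  -- (f *ᵖ g) (suc n) unfolds to f 0 * g (suc n) + (tail f *ᵖ g) n, which drives every induction on coefficients.
  tail : P.Series → P.Series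
  tail f n = f (suc n)

  -- Makes the tail of a product expressible by products again: `tail (f *ᵖ g)` unfolds to
  -- `scale (f 0) (tail g) +ᵖ tail f *ᵖ g`.
  scale : Carrier → P.Series → P.Series
  scale a f n = a * f n

  *ₛ-congˡ : ∀ f {g g′} → g ≈ᵖ g′ → f *ᵖ g ≈ᵖ f *ᵖ g′
  *ₛ-congˡ f g≈g′ zero    = +-congʳ (*-congˡ (g≈g′ 0))
  *ₛ-congˡ f g≈g′ (suc n) = +-cong (*-congˡ (g≈g′ (suc n))) (*ₛ-congˡ (tail f) g≈g′ n)

  *ₛ-congʳ : ∀ g {f f′} → f ≈ᵖ f′ → f *ᵖ g ≈ᵖ f′ *ᵖ g
  *ₛ-congʳ g f≈f′ zero    = +-congʳ (*-congʳ (f≈f′ 0))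
  *ₛ-congʳ g f≈f′ (suc n) = +-cong (*-congʳ (f≈f′ 0)) (*ₛ-congʳ g (λ k → f≈f′ (suc k)) n)

  *ₛ-distribʳ-+ₛ : ∀ h f g → (f +ᵖ g) *ᵖ h ≈ᵖ f *ᵖ h +ᵖ g *ᵖ h
  *ₛ-distribʳ-+ₛ h f g zero = begin
    (f 0 + g 0) * h 0 + 0#               ≈⟨ +-cong (distribʳ _ _ _) (sym (+-identityʳ 0#)) ⟩
    (f 0 * h 0 + g 0 * h 0) + (0# + 0#)  ≈⟨ interchange _ _ _ _ ⟩
    (f 0 * h 0 + 0#) + (g 0 * h 0 + 0#)  ∎
  *ₛ-distribʳ-+ₛ h f g (suc n) = begin
    (f 0 + g 0) * h (suc n) + ((tail f +ᵖ tail g) *ᵖ h) n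
      ≈⟨ +-cong (distribʳ _ _ _) (*ₛ-distribʳ-+ₛ h (tail f) (tail g) n) ⟩
    (f 0 * h (suc n) + g 0 * h (suc n)) + ((tail f *ᵖ h) n + (tail g *ᵖ h) n)
      ≈⟨ interchange _ _ _ _ ⟩
    (f *ᵖ h) (suc n) + (g *ᵖ h) (suc n) ∎

  scale-*ₛ : ∀ a f g → scale a f *ᵖ g ≈ᵖ scale a (f *ᵖ g)
  scale-*ₛ a f g zero = begin
    (a * f 0) * g 0 + 0#    ≈⟨ +-cong (*-assoc _ _ _) (sym (zeroʳ a)) ⟩
    a * (f 0 * g 0) + a * 0#  ≈⟨ distribˡ _ _ _ ⟨
    a * (f 0 * g 0 + 0#)    ∎
  scale-*ₛ a f g (suc n) = begin
    (a * f 0) * g (suc n) + (scale a (tail f) *ᵖ g) n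
      ≈⟨ +-cong (*-assoc _ _ _) (scale-*ₛ a (tail f) g n) ⟩
    a * (f 0 * g (suc n)) + a * (tail f *ᵖ g) n
      ≈⟨ distribˡ _ _ _ ⟨
    a * (f *ᵖ g) (suc n) ∎

  *ₛ-assoc : ∀ f g h → (f *ᵖ g) *ᵖ h ≈ᵖ f *ᵖ (g *ᵖ h)
  *ₛ-assoc f g h zero = begin
    (f 0 * g 0 + 0#) * h 0 + 0#    ≈⟨ +-congʳ (*-congʳ (+-identityʳ _)) ⟩
    (f 0 * g 0) * h 0 + 0#         ≈⟨ +-congʳ (*-assoc _ _ _) ⟩
    f 0 * (g 0 * h 0) + 0#         ≈⟨ +-congʳ (*-congˡ (+-identityʳ _)) ⟨
    f 0 * (g 0 * h 0 + 0#) + 0#    ∎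
  *ₛ-assoc f g h (suc n) = begin
    -- The left factor of the second summand is `tail (f *ᵖ g)`, unfolded; the induction hypothesis
    -- is then used at `tail f`.
    (f 0 * g 0 + 0#) * h (suc n) + ((scale (f 0) (tail g) +ᵖ tail f *ᵖ g) *ᵖ h) n
      ≈⟨ +-cong (trans (*-congʳ (+-identityʳ _)) (*-assoc _ _ _))
                (*ₛ-distribʳ-+ₛ h (scale (f 0) (tail g)) (tail f *ᵖ g) n) ⟩
    f 0 * (g 0 * h (suc n)) + ((scale (f 0) (tail g) *ᵖ h) n + ((tail f *ᵖ g) *ᵖ h) n)
      ≈⟨ +-congˡ (+-cong (scale-*ₛ (f 0) (tail g) h n) (*ₛ-assoc (tail f) g h n)) ⟩
    f 0 * (g 0 * h (suc n)) + (f 0 * (tail g *ᵖ h) n + (tail f *ᵖ (g *ᵖ h)) n)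
      ≈⟨ +-assoc _ _ _ ⟨
    (f 0 * (g 0 * h (suc n)) + f 0 * (tail g *ᵖ h) n) + (tail f *ᵖ (g *ᵖ h)) n
      ≈⟨ +-congʳ (distribˡ _ _ _) ⟨
    f 0 * (g *ᵖ h) (suc n) + (tail f *ᵖ (g *ᵖ h)) n ∎

  *ₛ-identityʳ : ∀ f → f *ᵖ P.1ₛ ≈ᵖ f
  *ₛ-identityʳ f zero    = trans (+-identityʳ _) (*-identityʳ _)
  *ₛ-identityʳ f (suc n) = begin
    f 0 * 0# + (tail f *ᵖ P.1ₛ) n  ≈⟨ +-cong (zeroʳ _) (*ₛ-identityʳ (tail f) n) ⟩
    0# + f (suc n)                 ≈⟨ +-identityˡ _ ⟩
    f (suc n)                      ∎

  -ₛ-distribˡ-*ₛ : ∀ f g → -ᵖ (f *ᵖ g) ≈ᵖ (-ᵖ f) *ᵖ g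
  -ₛ-distribˡ-*ₛ f g zero = begin
    - (f 0 * g 0 + 0#)      ≈⟨ -‿+-comm _ _ ⟨
    - (f 0 * g 0) + - 0#    ≈⟨ +-cong (-‿distribˡ-* _ _) -0#≈0# ⟩
    - f 0 * g 0 + 0#        ∎
  -ₛ-distribˡ-*ₛ f g (suc n) = begin
    - (f 0 * g (suc n) + (tail f *ᵖ g) n)      ≈⟨ -‿+-comm _ _ ⟨
    - (f 0 * g (suc n)) + - (tail f *ᵖ g) n    ≈⟨ +-cong (-‿distribˡ-* _ _) (-ₛ-distribˡ-*ₛ (tail f) g n) ⟩
    - f 0 * g (suc n) + ((-ᵖ tail f) *ᵖ g) n   ∎

  -- Reduces an identity about a quotient to one about a product, so no coefficient of the
  -- reciprocal has to be computed.
  quotient-unique : ∀ f q g g₀ → q *ᵖ g ≈ᵖ f → P.quotient f g g₀ ≈ᵖ q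
  quotient-unique f q g g₀ qg≈f n = begin
    (f *ᵖ g⁻¹) n           ≈⟨ *ₛ-congʳ g⁻¹ qg≈f n ⟨
    ((q *ᵖ g) *ᵖ g⁻¹) n    ≈⟨ *ₛ-assoc q g g⁻¹ n ⟩
    (q *ᵖ (g *ᵖ g⁻¹)) n    ≈⟨ *ₛ-congˡ q (P.recipₛ-inverse g g₀) n ⟩
    (q *ᵖ P.1ₛ) n          ≈⟨ *ₛ-identityʳ q n ⟩
    q n                    ∎
    where
    g⁻¹ : P.Series
    g⁻¹ = P.recipₛ g g₀

  *ₛ-1-X-zero : ∀ f → (f *ᵖ P.1-X) 0 ≈ f 0
  *ₛ-1-X-zero f = begin
    f 0 * (1# + - 0#) + 0#  ≈⟨ +-identityʳ _ ⟩
    f 0 * (1# + - 0#)       ≈⟨ *-congˡ (trans (+-congˡ -0#≈0#) (+-identityʳ 1#)) ⟩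
    f 0 * 1#                ≈⟨ *-identityʳ _ ⟩
    f 0                     ∎

  -- Passing to `tail f` lowers the index until only two terms remain; the leading terms dropped on
  -- the way meet coefficients of `1-X` of index at least 2, which vanish.
  *ₛ-1-X-suc : ∀ f n → (f *ᵖ P.1-X) (suc n) ≈ f (suc n) - f n
  *ₛ-1-X-suc f zero = begin
    f 0 * (0# + - 1#) + (tail f *ᵖ P.1-X) 0  ≈⟨ +-cong (*-congˡ (+-identityˡ _)) (*ₛ-1-X-zero (tail f)) ⟩
    f 0 * - 1# + f 1                         ≈⟨ +-congʳ (-‿distribʳ-* _ _) ⟨
    - (f 0 * 1#) + f 1                       ≈⟨ +-congʳ (-‿cong (*-identityʳ _)) ⟩
    - f 0 + f 1                              ≈⟨ +-comm _ _ ⟩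
    f 1 - f 0                                ∎
  *ₛ-1-X-suc f (suc n) = begin
    f 0 * (0# + - 0#) + (tail f *ᵖ P.1-X) (suc n)  ≈⟨ +-cong (*-congˡ (-‿inverseʳ 0#)) (*ₛ-1-X-suc (tail f) n) ⟩
    f 0 * 0# + (f (suc (suc n)) - f (suc n))       ≈⟨ +-congʳ (zeroʳ _) ⟩
    0# + (f (suc (suc n)) - f (suc n))             ≈⟨ +-identityˡ _ ⟩
    f (suc (suc n)) - f (suc n)                    ∎

  -- `sum` unfolds at its first term, whereas consecutive partial sums differ by the last one.
  sum-snoc : ∀ n (a : ℕ → Carrier) → sum {suc n} (λ i → a (toℕ i)) ≈ sum {n} (λ i → a (toℕ i)) + a n
  sum-snoc zero    a = +-comm _ _
  sum-snoc (suc n) a = trans (+-congˡ (sum-snoc n λ k → a (suc k))) (sym (+-assoc _ _ _))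

  -- Over the reals this unfolds to `Σ₁ n a`, so `harmonic` and every later `hyperharmonic` are
  -- instances of it by computation.
  partialSums : (ℕ → Carrier) → ℕ → Carrier
  partialSums a n = sum {n} λ i → a (suc (toℕ i))

  Σ≥1-coefficient : ∀ a → a 0 ≈ 0# → P.Σ≥1 a ≈ᵖ a
  Σ≥1-coefficient a a₀≈0 zero    = sym a₀≈0
  Σ≥1-coefficient a a₀≈0 (suc n) = refl

  -- Multiplication by `1-X` takes differences of consecutive coefficients, which inverts summation.
  Σ≥1-partialSums : ∀ a → P.Σ≥1 (partialSums a) *ᵖ P.1-X ≈ᵖ P.Σ≥1 a
  Σ≥1-partialSums a zero    = *ₛ-1-X-zero (P.Σ≥1 (partialSums a))
  Σ≥1-partialSums a (suc n) = begin
    (P.Σ≥1 (partialSums a) *ᵖ P.1-X) (suc n)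
      ≈⟨ *ₛ-1-X-suc (P.Σ≥1 (partialSums a)) n ⟩
    partialSums a (suc n) - P.Σ≥1 (partialSums a) n
      -- For `n = 0` the subtracted coefficient is the constant term that `Σ≥1` sets to `0#`; it
      -- agrees with the empty partial sum, hence `refl`.
      ≈⟨ +-cong (sum-snoc n λ k → a (suc k)) (-‿cong (Σ≥1-coefficient (partialSums a) refl n)) ⟩
    (partialSums a n + a (suc n)) - partialSums a n
      ≈⟨ +-congʳ (+-comm _ _) ⟩
    (a (suc n) + partialSums a n) - partialSums a n
      ≈⟨ +-assoc _ _ _ ⟩
    a (suc n) + (partialSums a n - partialSums a n)
      ≈⟨ +-congˡ (-‿inverseʳ _) ⟩
    a (suc n) + 0#
      ≈⟨ +-identityʳ _ ⟩
    a (suc n) ∎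

  Σ≥1-partialSums-^ : ∀ a r → P.Σ≥1 (partialSums a) *ᵖ (P.1-X P.^ₛ suc r) ≈ᵖ P.Σ≥1 a *ᵖ (P.1-X P.^ₛ r)
  Σ≥1-partialSums-^ a r n = trans
    (sym (*ₛ-assoc (P.Σ≥1 (partialSums a)) P.1-X (P.1-X P.^ₛ r) n))
    (*ₛ-congʳ (P.1-X P.^ₛ r) (Σ≥1-partialSums a) n)

open CommutativeRing ℝ-commutativeRing using (_-_; ring; semiring; setoid; *-commutativeSemigroup; refl; sym; trans; +-cong; +-congˡ; -‿cong; *-cong; *-congˡ; *-congʳ; *-assoc; *-comm; *-identityˡ; *-identityʳ; zeroˡ)
open import Algebra.Definitions.RawSemiring (Semiring.rawSemiring semiring) using (_^_) renaming (_×_ to _·_)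
open import Algebra.Properties.CommutativeSemigroup *-commutativeSemigroup using (interchange)
open import Algebra.Properties.Ring ring using (-0#≈0#; -‿distribʳ-*; -‿involutive; -1*x≈-x; x[y-z]≈xy-xz)
open import Algebra.Properties.Semiring.Mult semiring using (×-congʳ; ×-comm-*)
open import Relation.Binary.Reasoning.Setoid setoid
open CauchyProduct ℝ-commutativeRing

-- The generalised falling factorial is homogeneous of degree `k` in `x` and `μ` jointly: each of
-- its `k` factors absorbs one `c`.
falling-scale : ∀ c x μ k → c ^ k *ʳ falling x k μ ≃ falling (c *ʳ x) k (c *ʳ μ)
falling-scale c x μ zero    = *-identityˡ 1ℝ
falling-scale c x μ (suc k) = begin
  (c *ʳ c ^ k) *ʳ (falling x k μ *ʳ (x - k · μ))
    ≈⟨ *-congʳ {falling x k μ *ʳ (x - k · μ)} (*-comm c (c ^ k)) ⟩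
  (c ^ k *ʳ c) *ʳ (falling x k μ *ʳ (x - k · μ))
    ≈⟨ interchange (c ^ k) c (falling x k μ) (x - k · μ) ⟩
  (c ^ k *ʳ falling x k μ) *ʳ (c *ʳ (x - k · μ))
    ≈⟨ *-cong (falling-scale c x μ k) step ⟩
  falling (c *ʳ x) k (c *ʳ μ) *ʳ (c *ʳ x - k · (c *ʳ μ)) ∎
  where
  step : c *ʳ (x - k · μ) ≃ c *ʳ x - k · (c *ʳ μ)
  step = trans (x[y-z]≈xy-xz c x (k · μ))
               (+-congˡ {c *ʳ x} (-‿cong (×-comm-* k c μ)))

falling-cong : ∀ {x y μ ν} k → x ≃ y → μ ≃ ν → falling x k μ ≃ falling y k ν
falling-cong zero    x≃y μ≃ν = refl
falling-cong (suc k) x≃y μ≃ν =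
  *-cong (falling-cong k x≃y μ≃ν) (+-cong x≃y (-‿cong (×-congʳ k μ≃ν)))

module _ (ƛ : ℝ) (ƛ#0 : ƛ # 0ℝ) where

  private
    ƛ⁻¹ : ℝ
    ƛ⁻¹ = inverse ƛ ƛ#0

  harmonicTerm : ℕ → ℝ
  harmonicTerm k = ƛ⁻¹ *ʳ binomial ƛ k *ʳ (-ʳ 1ℝ) ^ (k ∸ 1)

  -- Homogeneity with `c = ƛ` sends the pair `1ℝ`, `ƛ⁻¹` to `ƛ`, `1ℝ`. It uses up `suc m` powers of
  -- `ƛ` where the logarithm supplies only `m`; the factor `ƛ⁻¹` makes up the difference.
  log1+-coefficient : ∀ m → log1+ ƛ ƛ#0 (suc m) ≃ ƛ⁻¹ *ʳ binomial ƛ (suc m)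
  log1+-coefficient m = begin
    ƛ ^ m *ʳ F *ʳ f                   ≈⟨ *-congʳ {f} unscale ⟨
    ƛ⁻¹ *ʳ falling ƛ (suc m) 1ℝ *ʳ f  ≈⟨ *-assoc ƛ⁻¹ (falling ƛ (suc m) 1ℝ) f ⟩
    ƛ⁻¹ *ʳ binomial ƛ (suc m)         ∎
    where
    F f : ℝ
    F = falling 1ℝ (suc m) ƛ⁻¹
    f = 1/ suc m !
    unscale : ƛ⁻¹ *ʳ falling ƛ (suc m) 1ℝ ≃ ƛ ^ m *ʳ F
    unscale = begin
      ƛ⁻¹ *ʳ falling ƛ (suc m) 1ℝ
        ≈⟨ *-congˡ {ƛ⁻¹} (falling-cong (suc m) (*-identityʳ ƛ) (inverseʳ ƛ ƛ#0)) ⟨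
      ƛ⁻¹ *ʳ falling (ƛ *ʳ 1ℝ) (suc m) (ƛ *ʳ ƛ⁻¹)
        ≈⟨ *-congˡ {ƛ⁻¹} (falling-scale ƛ 1ℝ ƛ⁻¹ (suc m)) ⟨
      ƛ⁻¹ *ʳ ((ƛ *ʳ ƛ ^ m) *ʳ F)
        ≈⟨ *-congˡ {ƛ⁻¹} (*-assoc ƛ (ƛ ^ m) F) ⟩
      ƛ⁻¹ *ʳ (ƛ *ʳ (ƛ ^ m *ʳ F))
        ≈⟨ *-assoc ƛ⁻¹ ƛ (ƛ ^ m *ʳ F) ⟨
      (ƛ⁻¹ *ʳ ƛ) *ʳ (ƛ ^ m *ʳ F)
        ≈⟨ *-congʳ {ƛ ^ m *ʳ F} (trans (*-comm ƛ⁻¹ ƛ) (inverseʳ ƛ ƛ#0)) ⟩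
      1ℝ *ʳ (ƛ ^ m *ʳ F)
        ≈⟨ *-identityˡ (ƛ ^ m *ʳ F) ⟩
      ƛ ^ m *ʳ F ∎

  -- Substituting `-t` gives the sign `(-1)^(m+1)` against `(-1)^m` in the harmonic term; the outer
  -- minus accounts for the extra factor.
  Σ≥1-harmonicTerm : Σ≥1 harmonicTerm ≈ₛ -ₛ log1- ƛ ƛ#0
  Σ≥1-harmonicTerm zero    = sym (trans (-‿cong (zeroˡ 1ℝ)) -0#≈0#)
  Σ≥1-harmonicTerm (suc m) = begin
    ƛ⁻¹ *ʳ binomial ƛ (suc m) *ʳ s    ≈⟨ *-congʳ {s} (log1+-coefficient m) ⟨
    c *ʳ s                            ≈⟨ -‿involutive (c *ʳ s) ⟨
    -ʳ -ʳ (c *ʳ s)                    ≈⟨ -‿cong (-‿distribʳ-* c s) ⟩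
    -ʳ (c *ʳ -ʳ s)                    ≈⟨ -‿cong (*-congˡ {c} (-1*x≈-x s)) ⟨
    -ʳ (c *ʳ (-ʳ 1ℝ *ʳ s))            ∎
    where
    c s : ℝ
    c = log1+ ƛ ƛ#0 (suc m)
    s = (-ʳ 1ℝ) ^ m

  Σ≥1-hyperharmonic : ∀ r → Σ≥1 (hyperharmonic ƛ ƛ#0 (suc r)) *ₛ (1-X ^ₛ suc r) ≈ₛ -ₛ log1- ƛ ƛ#0
  Σ≥1-hyperharmonic zero n = begin
    (Σ≥1 (harmonic ƛ ƛ#0) *ₛ (1-X ^ₛ 1)) n  ≈⟨ Σ≥1-partialSums-^ harmonicTerm 0 n ⟩
    (Σ≥1 harmonicTerm *ₛ 1ₛ) n              ≈⟨ *ₛ-identityʳ (Σ≥1 harmonicTerm) n ⟩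
    Σ≥1 harmonicTerm n                      ≈⟨ Σ≥1-harmonicTerm n ⟩
    (-ₛ log1- ƛ ƛ#0) n                      ∎
  Σ≥1-hyperharmonic (suc r) n = trans
    -- One factor of `1-X` lowers the order of the hyperharmonic numbers by one.
    (Σ≥1-partialSums-^ (hyperharmonic ƛ ƛ#0 (suc r)) (suc r) n)
    (Σ≥1-hyperharmonic r n)

  -- Both cases are empty sums; the split on `r` is what lets `hyperharmonic` reduce.
  hyperharmonic-zero : ∀ r → hyperharmonic ƛ ƛ#0 (suc r) 0 ≃ 0ℝ
  hyperharmonic-zero zero    = refl
  hyperharmonic-zero (suc r) = refl

theorem1 : (ƛ : ℝ) (ƛ#0 : ƛ # 0ℝ) (r : ℕ) .{{_ : NonZero r}} →
    (-ₛ (quotient (log1- ƛ ƛ#0) (1-X ^ₛ r) (1-X^-unit r)) ≈ₛ Σ≥1 (hyperharmonic ƛ ƛ#0 r))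
    × (hyperharmonic ƛ ƛ#0 r 0 ≃ 0ℝ)
theorem1 ƛ ƛ#0 (suc r) = gf , hyperharmonic-zero ƛ ƛ#0 r
  where
  Q : Series
  Q = 1-X ^ₛ suc r
  gf : -ₛ quotient (log1- ƛ ƛ#0) Q (1-X^-unit (suc r)) ≈ₛ Σ≥1 (hyperharmonic ƛ ƛ#0 (suc r))
  gf n = trans
    -- A quotient is a product with the reciprocal, so the minus sign moves onto the numerator.
    (-ₛ-distribˡ-*ₛ (log1- ƛ ƛ#0) (recipₛ Q (1-X^-unit (suc r))) n)
    (quotient-unique (-ₛ log1- ƛ ƛ#0) (Σ≥1 (hyperharmonic ƛ ƛ#0 (suc r))) Q (1-X^-unit (suc r)) (Σ≥1-hyperharmonic ƛ ƛ#0 r) n)
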